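{- For every $\alpha\in[0,\infty)$, the set $\{x\in(0,1):\lambda(x)\le\alpha\}$ is of the first Baire category in $(0,1)$; and the set $\{x\in(0,1):\lambda(x)=\infty\}$ is residual in $(0,1)$. Here $\lambda(x)$ denotes the exponent of convergence of the sequence of Engel digits of $x$.
   Context: Engel series: let $T:[0,1)\to[0,1)$ be defined by $T(0)=0$ and $T(x)=x\lceil 1/x\rceil-1$ for $x\in(0,1)$, where $\lceil y\rceil$ is the least integer not less than $y$. For $x\in(0,1)$ put $d_1(x)=\lceil 1/x\rceil$ and $d_{n+1}(x)=d_1(T^n(x))$ for $n\ge1$, as long as $T^n(x)\neq0$; these positive integers are the digits of the Engel expansion $x=\frac1{d_1(x)}+\frac1{d_1(x)d_2(x)}+\cdots$. If $T^k(x)=0$ for some $k$, the digit sequence is finite (this happens exactly when $x$ is rational); otherwise it is infinite. Exponent of convergence: for $x\in(0,1)$, $\lambda(x)=\inf\{s\ge0:\sum_{n\ge1}d_n(x)^{ -s}<\infty\}\in[0,\infty]$, the sum being over all digits of $x$ and $\inf\emptyset=\infty$. In particular $\lambda(x)=0$ if $x$ is rational. A set is of the first Baire category in $(0,1)$ if it is a countable union of nowhere dense sets; a set is residual in $(0,1)$ if its complement in $(0,1)$ is of the first Baire category. -}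

module Defs where

open import Algebra.Definitions.RawSemiring using () renaming (_^_ to pow)
import Algebra.Properties.Semiring.Exp as Exp
open import Algebra.Bundles using (CommutativeRing)
open import Axiom.ExcludedMiddle using (ExcludedMiddle)
open import Data.Bool.Base using (Bool)
import Data.Bool.Base as Bool
open import Data.Empty using (⊥-elim)
import Data.Integer.Base as ℤ
import Data.Integer.Properties as ℤ
open import Data.Maybe.Base using (Maybe; just; nothing; maybe′)
open import Data.Nat.Base as ℕ using (ℕ; zero; suc)
open import Data.Nat.GeneralisedArithmetic using (iterate)
import Data.Nat.Properties as ℕ
open import Data.Product.Base using (Σ-syntax; ∃; ∃₂; ∃-syntax; _×_; _,_; proj₁; proj₂)
open import Data.Rational.Base as ℚ using (ℚ; 0ℚ; 1ℚ; ↥_; ↧_; ↧ₙ_; mkℚ)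
import Data.Rational.Literals as ℚ using (fromℤ)
import Data.Rational.Properties as ℚ
open import Level using (0ℓ)
open import Relation.Binary.PropositionalEquality
  using (_≡_; refl; sym; trans; cong; subst; subst₂)
open import Relation.Nullary.Construct.Add.Supremum using (_⁺; ⊤⁺; [_])
open import Relation.Nullary.Decidable
  using (Dec; yes; no; ⌊_⌋; toWitness; fromWitness)
open import Relation.Nullary.Negation using (¬_)
open import Relation.Unary using (Pred; _∈_; _∉_; _⊆′_; _≐_; ⋃; ∁; Empty)

infixr 8 _^ℚ_
_^ℚ_ : ℚ → ℕ → ℚ
_^ℚ_ = pow ℚ.+-*-rawSemiring

fromℕ : ℕ → ℚ
fromℕ n = ℚ.fromℤ (ℤ.+ n)

opaque
  below : ∀ q → ∃[ p ] p ℚ.< q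
  below q = q ℚ.- 1ℚ ,
    subst (q ℚ.- 1ℚ ℚ.<_) (ℚ.+-identityʳ q)
      (ℚ.+-monoʳ-< q (ℚ.negative⁻¹ (ℚ.- 1ℚ)))

  fromℕ-mono : ∀ {m n} → m ℕ.≤ n → fromℕ m ℚ.≤ fromℕ n
  fromℕ-mono m≤n = ℚ.*≤* (ℤ.*-monoʳ-≤-nonNeg (ℤ.+ 1) (ℤ.+≤+ m≤n))

  0≤fromℕ : ∀ n → 0ℚ ℚ.≤ fromℕ n
  0≤fromℕ n = fromℕ-mono {0} {n} ℕ.z≤n

  archimedean : ∀ q → ∃[ n ] q ℚ.≤ fromℕ n
  archimedean q@(mkℚ z d _) = ℤ.∣ z ∣ , ℚ.*≤* (begin
    z ℤ.* ℤ.+ 1                 ≡⟨ ℤ.*-identityʳ z ⟩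
    z                           ≤⟨ i≤∣i∣ z ⟩
    ℤ.+ ℤ.∣ z ∣                 ≤⟨ ℤ.+≤+ (ℕ.m≤m*n ℤ.∣ z ∣ (suc d)) ⟩
    ℤ.+ (ℤ.∣ z ∣ ℕ.* suc d)     ≡⟨ ℤ.pos-* ℤ.∣ z ∣ (suc d) ⟩
    ℤ.+ ℤ.∣ z ∣ ℤ.* ℤ.+ suc d   ∎)
    where
    open ℤ.≤-Reasoning
    i≤∣i∣ : ∀ i → i ℤ.≤ ℤ.+ ℤ.∣ i ∣
    i≤∣i∣ (ℤ.+ _)    = ℤ.≤-refl
    i≤∣i∣ ℤ.-[1+ _ ] = ℤ.-≤+

  *-mono : ∀ {p q r s} → 0ℚ ℚ.≤ p → 0ℚ ℚ.≤ s →
           p ℚ.≤ q → r ℚ.≤ s → p ℚ.* r ℚ.≤ q ℚ.* s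
  *-mono {p} {q} {r} {s} 0≤p 0≤s p≤q r≤s = ℚ.≤-trans
    (ℚ.*-monoˡ-≤-nonNeg p {{ℚ.nonNegative 0≤p}} r≤s)
    (ℚ.*-monoʳ-≤-nonNeg s {{ℚ.nonNegative 0≤s}} p≤q)

  ^-nonNeg : ∀ {p} n → 0ℚ ℚ.≤ p → 0ℚ ℚ.≤ p ^ℚ n
  ^-nonNeg zero    _   = ℚ.nonNegative⁻¹ 1ℚ
  ^-nonNeg {p} (suc n) 0≤p =
    subst (ℚ._≤ p ℚ.* p ^ℚ n) (ℚ.*-zeroˡ 0ℚ)
      (*-mono {0ℚ} {p} {0ℚ} {p ^ℚ n} ℚ.≤-refl (^-nonNeg n 0≤p) 0≤p (^-nonNeg n 0≤p))

  ^-monoˡ-≤ : ∀ {p q} n → 0ℚ ℚ.≤ p → p ℚ.≤ q → p ^ℚ n ℚ.≤ q ^ℚ n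
  ^-monoˡ-≤ zero    _   _   = ℚ.≤-refl
  ^-monoˡ-≤ (suc n) 0≤p p≤q =
    *-mono 0≤p (^-nonNeg n (ℚ.≤-trans 0≤p p≤q)) p≤q (^-monoˡ-≤ n 0≤p p≤q)

  ^-monoˡ-< : ∀ {p q} n → 0ℚ ℚ.< p → p ℚ.< q → p ^ℚ suc n ℚ.< q ^ℚ suc n
  ^-monoˡ-< {p} {q} n 0<p p<q = ℚ.<-≤-trans
    (ℚ.*-monoˡ-<-pos (p ^ℚ n) {{ℚ.positive (^-pos n)}} p<q)
    (ℚ.*-monoˡ-≤-nonNeg q {{ℚ.nonNegative (ℚ.<⇒≤ (ℚ.<-trans 0<p p<q))}}
      (^-monoˡ-≤ n (ℚ.<⇒≤ 0<p) (ℚ.<⇒≤ p<q)))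
    where
    ^-pos : ∀ n → 0ℚ ℚ.< p ^ℚ n
    ^-pos zero    = ℚ.positive⁻¹ 1ℚ
    ^-pos (suc n) = subst (ℚ._< p ℚ.* p ^ℚ n) (ℚ.*-zeroˡ (p ^ℚ n))
      (ℚ.*-monoˡ-<-pos (p ^ℚ n) {{ℚ.positive (^-pos n)}} 0<p)

  1≤^ : ∀ {p} n → 1ℚ ℚ.≤ p → 1ℚ ℚ.≤ p ^ℚ n
  1≤^ zero    _   = ℚ.≤-refl
  1≤^ {p} (suc n) 1≤p = subst (ℚ._≤ p ℚ.* p ^ℚ n) (ℚ.*-identityˡ 1ℚ)
    (*-mono {1ℚ} {p} {1ℚ} {p ^ℚ n} 0≤1 (ℚ.≤-trans 0≤1 (1≤^ n 1≤p)) 1≤p (1≤^ n 1≤p))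
    where
    0≤1 : 0ℚ ℚ.≤ 1ℚ
    0≤1 = ℚ.nonNegative⁻¹ 1ℚ

  ^-monoʳ-≤ : ∀ {p m n} → 1ℚ ℚ.≤ p → m ℕ.≤ n → p ^ℚ m ℚ.≤ p ^ℚ n
  ^-monoʳ-≤ {p} {n = n} 1≤p ℕ.z≤n = 1≤^ n 1≤p
  ^-monoʳ-≤ {p} 1≤p (ℕ.s≤s m≤n) =
    ℚ.*-monoˡ-≤-nonNeg p {{ℚ.nonNegative (ℚ.≤-trans (ℚ.nonNegative⁻¹ 1ℚ) 1≤p)}}
      (^-monoʳ-≤ 1≤p m≤n)

-- Real numbers: lower Dedekind cuts of ℚ.  Cuts are Bool-valued so that
-- ℝ lives in Set; under excluded middle every predicate is of this form.

record ℝ : Set where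
  field
    mem       : ℚ → Bool
    inhabited : ∃[ q ] Bool.T (mem q)
    bounded   : ∃[ q ] ¬ Bool.T (mem q)
    downward  : ∀ {p q} → p ℚ.< q → Bool.T (mem q) → Bool.T (mem p)
    rounded   : ∀ {p} → Bool.T (mem p) → ∃[ q ] p ℚ.< q × Bool.T (mem q)

-- q ∈ cut x means q < x.
cut : ℝ → Pred ℚ 0ℓ
cut x q = Bool.T (ℝ.mem x q)

infix 4 _≤_ _<_

_≤_ : ℝ → ℝ → Set
x ≤ y = cut x ⊆′ cut y

_<_ : ℝ → ℝ → Set
x < y = ∃[ q ] q ∈ cut y × q ∉ cut x

fromℚ : ℚ → ℝ
fromℚ q = record
  { mem       = λ p → ⌊ p ℚ.<? q ⌋
  ; inhabited = let p , p<q = below q in p , fromWitness p<q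
  ; bounded   = q , λ q∈ → ℚ.<-irrefl refl (toWitness {a? = q ℚ.<? q} q∈)
  ; downward  = λ p<r r∈ → fromWitness (ℚ.<-trans p<r (toWitness r∈))
  ; rounded   = λ p∈ → let m , p<m , m<q = ℚ.<-dense (toWitness p∈) in
                m , p<m , fromWitness m<q
  }

0ℝ 1ℝ : ℝ
0ℝ = fromℚ 0ℚ
1ℝ = fromℚ 1ℚ

opaque
  ∈∉⇒≤ : ∀ x {p q} → p ∈ cut x → q ∉ cut x → p ℚ.≤ q
  ∈∉⇒≤ x p∈ q∉ = ℚ.≮⇒≥ λ q<p → q∉ (ℝ.downward x q<p p∈)

  fromℚ-≤ : ∀ x {p q} → fromℚ p ≤ x → q ∉ cut x → p ℚ.≤ q
  fromℚ-≤ x p≤x q∉ = ℚ.≮⇒≥ λ q<p → q∉ (p≤x _ (fromWitness q<p))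

-- The space (0,1), with the topology generated by open intervals.
record 𝕀 : Set where
  field
    value : ℝ
    0<    : 0ℝ < value
    <1    : value < 1ℝ

open 𝕀 public using (value)

infix 4 _∈⟨_,_⟩
_∈⟨_,_⟩ : 𝕀 → ℝ → ℝ → Set
x ∈⟨ a , b ⟩ = a < value x × value x < b

interior : Pred 𝕀 0ℓ → Pred 𝕀 0ℓ
interior A x = ∃₂ λ a b → x ∈⟨ a , b ⟩ × (∀ y → y ∈⟨ a , b ⟩ → y ∈ A)

closure : Pred 𝕀 0ℓ → Pred 𝕀 0ℓ
closure A x = ∀ a b → x ∈⟨ a , b ⟩ → ∃[ y ] y ∈⟨ a , b ⟩ × y ∈ A

NowhereDense : Pred 𝕀 0ℓ → Set
NowhereDense A = Empty (interior (closure A))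

FirstCategory : Pred 𝕀 0ℓ → Set₁
FirstCategory A =
  Σ[ N ∈ (ℕ → Pred 𝕀 0ℓ) ] (∀ n → NowhereDense (N n)) × A ≐ ⋃ ℕ N

Residual : Pred 𝕀 0ℓ → Set₁
Residual A = FirstCategory (∁ A)

-- Everything below needs classical logic: the digit map is discontinuous
-- and the exponent of convergence is an infimum of an arbitrary set.

module Classical (em : ExcludedMiddle 0ℓ) where

  opaque
    sup : (E : Pred ℚ 0ℓ) → ∃ E → (∃[ u ] ∀ e → e ∈ E → e ℚ.≤ u) → ℝ
    sup E (e₀ , e₀∈E) (u , ub) = record
      { mem       = λ q → ⌊ above? q ⌋
      ; inhabited = let p , p<e₀ = below e₀ in p , fromWitness (e₀ , e₀∈E , p<e₀)
      ; bounded   = u , λ u∈ → let e , e∈E , u<e = toWitness {a? = above? u} u∈ in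
                    ℚ.<-irrefl refl (ℚ.<-≤-trans u<e (ub e e∈E))
      ; downward  = λ p<q q∈ → let e , e∈E , q<e = toWitness q∈ in
                    fromWitness (e , e∈E , ℚ.<-trans p<q q<e)
      ; rounded   = λ p∈ → let e , e∈E , p<e = toWitness p∈
                               m , p<m , m<e = ℚ.<-dense p<e in
                    m , p<m , fromWitness (e , e∈E , m<e)
      }
      where
      above? : ∀ q → Dec (∃[ e ] e ∈ E × q ℚ.< e)
      above? q = em

    ∈-sup⁺ : ∀ {E ne ub q} e → e ∈ E → q ℚ.< e → q ∈ cut (sup E ne ub)
    ∈-sup⁺ e e∈E q<e = fromWitness (e , e∈E , q<e)

    ∈-sup⁻ : ∀ {E ne ub q} → q ∈ cut (sup E ne ub) → ∃[ e ] e ∈ E × q ℚ.< e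
    ∈-sup⁻ = toWitness

  infixl 6 _+_
  _+_ : ℝ → ℝ → ℝ
  x + y = sup (λ e → ∃₂ λ p q → p ∈ cut x × q ∈ cut y × e ≡ p ℚ.+ q)
    (let p , p∈ = ℝ.inhabited x ; q , q∈ = ℝ.inhabited y in
      p ℚ.+ q , p , q , p∈ , q∈ , refl)
    (let u , u∉ = ℝ.bounded x ; v , v∉ = ℝ.bounded y in
      u ℚ.+ v , λ { _ (p , q , p∈ , q∈ , refl) →
        ℚ.+-mono-≤ (∈∉⇒≤ x p∈ u∉) (∈∉⇒≤ y q∈ v∉) })

  infixl 7 _·_
  _·_ : ℕ → ℝ → ℝ
  n · x = sup (λ e → ∃[ p ] p ∈ cut x × e ≡ fromℕ n ℚ.* p)
    (let p , p∈ = ℝ.inhabited x in fromℕ n ℚ.* p , p , p∈ , refl)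
    (let u , u∉ = ℝ.bounded x in
      fromℕ n ℚ.* u , λ { _ (p , p∈ , refl) →
        ℚ.*-monoˡ-≤-nonNeg (fromℕ n) {{ℚ.nonNegative (0≤fromℕ n)}} (∈∉⇒≤ x p∈ u∉) })

  RecipBelow : ℝ → Pred ℚ 0ℓ
  RecipBelow x e = ∃[ r ] r ∉ cut x × e ℚ.* r ℚ.≤ 1ℚ

  opaque
    0∈RecipBelow : ∀ x → 0ℚ ∈ RecipBelow x
    0∈RecipBelow x = let u , u∉ = ℝ.bounded x in
      u , u∉ , subst (ℚ._≤ 1ℚ) (sym (ℚ.*-zeroˡ u)) (ℚ.nonNegative⁻¹ 1ℚ)

    recipBound : ∀ x → 0ℝ < x → ∃[ v ] ∀ e → e ∈ RecipBelow x → e ℚ.≤ v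
    recipBound x (l , l∈ , l∉0) with ℝ.rounded x l∈
    ... | k , l<k , k∈ = ℚ.1/ k , λ e (r , r∉ , er≤1) → ℚ.≮⇒≥ λ 1/k<e →
          ℚ.<-irrefl refl (begin-strict
            1ℚ            ≡⟨ ℚ.*-inverseˡ k ⟨
            ℚ.1/ k ℚ.* k  <⟨ ℚ.*-monoˡ-<-pos k 1/k<e ⟩
            e ℚ.* k       ≤⟨ ℚ.*-monoˡ-≤-nonNeg e
                               {{ℚ.nonNegative (ℚ.<⇒≤ (ℚ.<-trans (ℚ.positive⁻¹ (ℚ.1/ k)) 1/k<e))}}
                               (∈∉⇒≤ x k∈ r∉) ⟩
            e ℚ.* r       ≤⟨ er≤1 ⟩
            1ℚ            ∎)
      where
      open ℚ.≤-Reasoning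
      instance
        k>0 : ℚ.Positive k
        k>0 = ℚ.positive (ℚ.≤-<-trans (ℚ.≮⇒≥ (λ l<0 → l∉0 (fromWitness l<0))) l<k)
        k≢0 : ℚ.NonZero k
        k≢0 = ℚ.pos⇒nonZero k
        1/k>0 : ℚ.Positive (ℚ.1/ k)
        1/k>0 = ℚ.1/pos⇒pos k

  -- 1/x is the supremum of the rationals e with e ≤ 1/r for some rational
  -- r ≥ x.
  recip : (x : ℝ) → 0ℝ < x → ℝ
  recip x 0<x = sup (RecipBelow x) (0ℚ , 0∈RecipBelow x) (recipBound x 0<x)

  opaque
    least : (P : Pred ℕ 0ℓ) → ∀ k → P k → ∃[ n ] P n × (∀ m → P m → n ℕ.≤ m)
    least P k Pk with em {P 0}
    least P k       Pk | yes P0 = 0 , P0 , λ _ _ → ℕ.z≤n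
    least P zero    Pk | no ¬P0 = ⊥-elim (¬P0 Pk)
    least P (suc k) Pk | no ¬P0 with least (λ n → P (suc n)) k Pk
    ... | n , Pn , n≤ = suc n , Pn ,
          λ { zero P0 → ⊥-elim (¬P0 P0) ; (suc m) Pm → ℕ.s≤s (n≤ m Pm) }

    natBound : ∀ x → ∃[ n ] x ≤ fromℚ (fromℕ n)
    natBound x = let u , u∉ = ℝ.bounded x ; n , u≤n = archimedean u in
      n , λ _ p∈ → let q , p<q , q∈ = ℝ.rounded x p∈ in
        fromWitness (ℚ.<-≤-trans p<q (ℚ.≤-trans (∈∉⇒≤ x q∈ u∉) u≤n))

  -- The least natural number not less than x; for x > 0 this is the least
  -- integer not less than x.
  ⌈_⌉ : ℝ → ℕ
  ⌈ x ⌉ = let k , x≤k = natBound x in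
    proj₁ (least (λ n → x ≤ fromℚ (fromℕ n)) k x≤k)

  -- d ^ s = sup { d ^ r : r rational, 0 ≤ r ≤ s } for d ≥ 1 and s ≥ 0,
  -- where for r = a/b in lowest terms and e ≥ 0,
  -- e ≤ d ^ r is expressed as e ^ b ≤ d ^ a.
  PowerBelow : ℕ → ℝ → Pred ℚ 0ℓ
  PowerBelow d s e = 0ℚ ℚ.≤ e × ∃[ r ] 0ℚ ℚ.≤ r × fromℚ r ≤ s ×
                     e ^ℚ (↧ₙ r) ℚ.≤ fromℕ d ^ℚ ℤ.∣ ↥ r ∣

  opaque
    1∈PowerBelow : ∀ d s → 0ℝ ≤ s → 1ℚ ∈ PowerBelow d s
    1∈PowerBelow d s 0≤s =
      ℚ.nonNegative⁻¹ 1ℚ , 0ℚ , ℚ.≤-refl , 0≤s , ℚ.≤-refl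

    powerBound : ∀ d s → ∃[ u ] ∀ e → e ∈ PowerBelow d s → e ℚ.≤ u
    powerBound d s with ℝ.bounded s
    ... | v , v∉ with archimedean v
    ... | m , v≤m = B ^ℚ m , λ e (0≤e , r , 0≤r , r≤s , le) → ℚ.≮⇒≥ λ Bᵐ<e →
            contra e r 0≤r (ℚ.≤-trans (fromℚ-≤ s r≤s v∉) v≤m) le Bᵐ<e
      where
      B : ℚ
      B = fromℕ (suc d)
      1≤B : 1ℚ ℚ.≤ B
      1≤B = fromℕ-mono {1} (ℕ.s≤s ℕ.z≤n)
      contra : ∀ e r → 0ℚ ℚ.≤ r → r ℚ.≤ fromℕ m →
               e ^ℚ (↧ₙ r) ℚ.≤ fromℕ d ^ℚ ℤ.∣ ↥ r ∣ → ¬ B ^ℚ m ℚ.< e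
      contra e r@(mkℚ (ℤ.+ a) b-1 _) _ r≤m le Bᵐ<e = ℚ.<-irrefl refl (begin-strict
        (B ^ℚ m) ^ℚ suc b-1    <⟨ ^-monoˡ-< b-1 0<Bᵐ Bᵐ<e ⟩
        e ^ℚ suc b-1           ≤⟨ le ⟩
        fromℕ d ^ℚ a           ≤⟨ ^-monoˡ-≤ a (0≤fromℕ d) (fromℕ-mono (ℕ.n≤1+n d)) ⟩
        B ^ℚ a                 ≤⟨ ^-monoʳ-≤ 1≤B a≤mb ⟩
        B ^ℚ (m ℕ.* suc b-1)   ≡⟨ Exp.^-assocʳ (CommutativeRing.semiring ℚ.+-*-commutativeRing) B m (suc b-1) ⟨
        (B ^ℚ m) ^ℚ suc b-1    ∎)
        where
        open ℚ.≤-Reasoning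
        0<Bᵐ : 0ℚ ℚ.< B ^ℚ m
        0<Bᵐ = ℚ.<-≤-trans (ℚ.positive⁻¹ 1ℚ) (1≤^ m 1≤B)
        a≤mb : a ℕ.≤ m ℕ.* suc b-1
        a≤mb = ℤ.drop‿+≤+ (subst₂ ℤ._≤_ (ℤ.*-identityʳ (ℤ.+ a)) (sym (ℤ.pos-* m (suc b-1)))
                 (ℚ.drop-*≤* r≤m))
      contra e (mkℚ ℤ.-[1+ _ ] _ _) 0≤r _ _ _ with ℚ.drop-*≤* 0≤r
      ... | ()

  power : ℕ → (s : ℝ) → 0ℝ ≤ s → ℝ
  power d s 0≤s = sup (PowerBelow d s) (1ℚ , 1∈PowerBelow d s 0≤s) (powerBound d s)

  opaque
    power-pos : ∀ d s (0≤s : 0ℝ ≤ s) → 0ℝ < power d s 0≤s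
    power-pos d s 0≤s =
      0ℚ , ∈-sup⁺ 1ℚ (1∈PowerBelow d s 0≤s) (ℚ.positive⁻¹ 1ℚ) ,
      λ ()

  -- Infimum as the supremum of the rational lower bounds.
  inf : (S : Pred ℝ 0ℓ) → (∀ s → s ∈ S → 0ℝ ≤ s) → ∃ S → ℝ
  inf S 0≤S (s₀ , s₀∈S) = sup (λ e → ∀ s → s ∈ S → fromℚ e ≤ s)
    (0ℚ , 0≤S)
    (let u , u∉ = ℝ.bounded s₀ in u , λ e e≤S → fromℚ-≤ s₀ (e≤S s₀ s₀∈S) u∉)

  -- The infimum in [0,∞] of a set of nonnegative reals; ⊤⁺ is ∞.
  inf⁺ : (S : Pred ℝ 0ℓ) → (∀ s → s ∈ S → 0ℝ ≤ s) → ℝ ⁺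
  inf⁺ S 0≤S with em {∃ S}
  ... | yes ne = [ inf S 0≤S ne ]
  ... | no  _  = ⊤⁺

  ∑< : ℕ → (ℕ → ℝ) → ℝ
  ∑< zero    f = 0ℝ
  ∑< (suc n) f = ∑< n f + f n

  SeriesConverges : (ℕ → ℝ) → Set
  SeriesConverges f = ∃[ S ] ∀ ε → 0ℝ < ε → ∃[ N ] ∀ n → N ℕ.≤ n →
    ∑< n f < S + ε × S < ∑< n f + ε

  engelMap : ∀ x → Dec (0ℝ < x) → ℝ
  engelMap x (yes 0<x) = ⌈ recip x 0<x ⌉ · x + fromℚ (ℚ.- 1ℚ)
  engelMap x (no  _)   = 0ℝ

  engelDigit : ∀ x → Dec (0ℝ < x) → Maybe ℕ
  engelDigit x (yes 0<x) = just ⌈ recip x 0<x ⌉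
  engelDigit x (no  _)   = nothing

  -- On [0,1), where ¬ 0 < x means x = 0.
  T : ℝ → ℝ
  T x = engelMap x em

  firstDigit : ℝ → Maybe ℕ
  firstDigit x = engelDigit x em

  -- Indices start at 0: digit x n is the (n+1)-st digit, if there is one.
  digit : ℝ → ℕ → Maybe ℕ
  digit x n = firstDigit (iterate T x n)

  -- The term d⁻ˢ for a digit d; missing digits contribute nothing.
  term : (s : ℝ) → 0ℝ ≤ s → Maybe ℕ → ℝ
  term s 0≤s = maybe′ (λ d → recip (power d s 0≤s) (power-pos d s 0≤s)) 0ℝ

  ConvergenceSet : ℝ → Pred ℝ 0ℓ
  ConvergenceSet x s =
    Σ[ 0≤s ∈ 0ℝ ≤ s ] SeriesConverges (λ n → term s 0≤s (digit x n))

  exponent : ℝ → ℝ ⁺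
  exponent x = inf⁺ (ConvergenceSet x) (λ _ → proj₁)

open import Relation.Binary.Construct.Add.Supremum.NonStrict _≤_ public using (_≤⁺_)

{-# OPTIONS --safe #-}
module Submission where

-- If ∑ d_n⁻ˢ converges, then by the Cauchy criterion a digit d cannot occur
-- many times in a row late in the expansion: for some M (at least s, and beyond
-- the Cauchy index) runs of d past index M have length at most of order dᴹ.
-- For fixed M this excludes an open dense set: the Engel orbit of a rational r
-- reaches 0, so to the right of r some iterate of T is an affine expansion onto
-- a neighbourhood (0, η], and just below the fixed point 1/e of the branch
-- x ↦ (e + 1) x − 1, with 1/e < η, the digit e + 1 repeats as often as desired.
-- Real orbits are tracked only through rational bounds a < x ≤ b.

open import Axiom.ExcludedMiddle using (ExcludedMiddle)
open import Data.Product.Base using (_×_)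
open import Level using (0ℓ)
open import Relation.Binary.PropositionalEquality using (_≡_)
open import Relation.Nullary.Construct.Add.Supremum using (⊤⁺; [_])
open import Defs

open import Data.Empty using (⊥-elim)
import Data.Integer.Base as ℤ
import Data.Integer.Properties as ℤ
open import Data.Maybe.Base using (Maybe; just)
open import Data.Nat.Base as ℕ using (ℕ; zero; suc)
import Data.Nat.DivMod as ℕ
open import Data.Nat.GeneralisedArithmetic using (iterate)
open import Data.Nat.Induction using (<-wellFounded)
import Data.Nat.Properties as ℕ
open import Data.Product.Base using (∃; ∃₂; ∃-syntax; _,_; proj₁; proj₂)
open import Data.Rational.Base as ℚ using (ℚ; 0ℚ; 1ℚ; mkℚ)
import Data.Rational.Properties as ℚ
open import Data.Rational.Solver using (module +-*-Solver)
open import Data.Rational.Unnormalised.Base using (*≡*)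
import Data.Rational.Unnormalised.Properties as ℚᵘ
open import Data.Sum.Base using (inj₁; inj₂)
open import Function.Base using (_∘_)
open import Induction.WellFounded using (Acc; acc)
open import Relation.Binary.PropositionalEquality using (refl; sym; trans; cong; cong₂; subst; subst₂;
  module ≡-Reasoning)
open import Relation.Nullary.Decidable using (yes; no; toWitness; fromWitness)
open import Relation.Nullary.Negation using (¬_)
open import Relation.Unary using (Pred; _∈_; _∉_; _∩_)

open +-*-Solver using (solve; _:+_; _:*_; _:-_; _:=_; con)

-- Rational arithmetic

0<1ℚ : 0ℚ ℚ.< 1ℚ
0<1ℚ = ℚ.positive⁻¹ 1ℚ

<⇒≱ : ∀ {p q} → p ℚ.< q → ¬ q ℚ.≤ p
<⇒≱ p<q q≤p = ℚ.<-irrefl refl (ℚ.<-≤-trans p<q q≤p)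

≤-slack : ∀ {p q} d → 0ℚ ℚ.≤ d → p ℚ.+ d ≡ q → p ℚ.≤ q
≤-slack {p} d 0≤d refl = subst (ℚ._≤ p ℚ.+ d) (ℚ.+-identityʳ p) (ℚ.+-monoʳ-≤ p 0≤d)

<-slack : ∀ {p q} d → 0ℚ ℚ.< d → p ℚ.+ d ≡ q → p ℚ.< q
<-slack {p} d 0<d refl = subst (ℚ._< p ℚ.+ d) (ℚ.+-identityʳ p) (ℚ.+-monoʳ-< p 0<d)

p<q⇒0<q-p : ∀ {p q} → p ℚ.< q → 0ℚ ℚ.< q ℚ.- p
p<q⇒0<q-p {p} {q} p<q = subst (ℚ._< q ℚ.- p) (ℚ.+-inverseʳ p) (ℚ.+-monoˡ-< (ℚ.- p) p<q)

*-monoʳ-≤ : ∀ {p q r} → 0ℚ ℚ.≤ r → p ℚ.≤ q → r ℚ.* p ℚ.≤ r ℚ.* q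
*-monoʳ-≤ {r = r} 0≤r = ℚ.*-monoˡ-≤-nonNeg r {{ℚ.nonNegative 0≤r}}

*-monoʳ-< : ∀ {p q r} → 0ℚ ℚ.< r → p ℚ.< q → r ℚ.* p ℚ.< r ℚ.* q
*-monoʳ-< {r = r} 0<r = ℚ.*-monoʳ-<-pos r {{ℚ.positive 0<r}}

*-cancelˡ-< : ∀ {p q r} → 0ℚ ℚ.≤ r → r ℚ.* p ℚ.< r ℚ.* q → p ℚ.< q
*-cancelˡ-< {r = r} 0≤r = ℚ.*-cancelˡ-<-nonNeg r {{ℚ.nonNegative 0≤r}}

*-pos : ∀ {p q} → 0ℚ ℚ.< p → 0ℚ ℚ.< q → 0ℚ ℚ.< p ℚ.* q
*-pos {p} {q} 0<p 0<q = subst (ℚ._< p ℚ.* q) (ℚ.*-zeroʳ p) (*-monoʳ-< 0<p 0<q)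

*-nonNeg : ∀ {p q} → 0ℚ ℚ.≤ p → 0ℚ ℚ.≤ q → 0ℚ ℚ.≤ p ℚ.* q
*-nonNeg {p} {q} 0≤p 0≤q = subst (ℚ._≤ p ℚ.* q) (ℚ.*-zeroʳ p) (*-monoʳ-≤ 0≤p 0≤q)

⊓-pos : ∀ {p q} → 0ℚ ℚ.< p → 0ℚ ℚ.< q → 0ℚ ℚ.< p ℚ.⊓ q
⊓-pos {p} {q} 0<p 0<q with ℚ.⊓-sel p q
... | inj₁ eq = subst (0ℚ ℚ.<_) (sym eq) 0<p
... | inj₂ eq = subst (0ℚ ℚ.<_) (sym eq) 0<q

inverse : ∀ {p} → 0ℚ ℚ.< p → ∃[ ρ ] 0ℚ ℚ.< ρ × p ℚ.* ρ ≡ 1ℚ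
inverse {p} 0<p = ℚ.1/ p , ℚ.positive⁻¹ (ℚ.1/ p) {{ℚ.1/pos⇒pos p}} , ℚ.*-inverseʳ p
  where
  instance
    p>0 : ℚ.Positive p
    p>0 = ℚ.positive 0<p
    p≢0 : ℚ.NonZero p
    p≢0 = ℚ.pos⇒nonZero p

fromℕ-+ : ∀ m n → fromℕ (m ℕ.+ n) ≡ fromℕ m ℚ.+ fromℕ n
fromℕ-+ m n = ℚ.toℚᵘ-injective (ℚᵘ.≃-sym (ℚᵘ.≃-trans (ℚ.toℚᵘ-homo-+ (fromℕ m) (fromℕ n))
  (*≡* (cong (ℤ._* ℤ.+ 1) (cong₂ ℤ._+_ (ℤ.*-identityʳ (ℤ.+ m)) (ℤ.*-identityʳ (ℤ.+ n)))))))

fromℕ-* : ∀ m n → fromℕ (m ℕ.* n) ≡ fromℕ m ℚ.* fromℕ n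
fromℕ-* m n = ℚ.toℚᵘ-injective (ℚᵘ.≃-sym (ℚᵘ.≃-trans (ℚ.toℚᵘ-homo-* (fromℕ m) (fromℕ n))
  (*≡* (cong (ℤ._* ℤ.+ 1) (sym (ℤ.pos-* m n))))))

0<fromℕ-suc : ∀ n → 0ℚ ℚ.< fromℕ (suc n)
0<fromℕ-suc n = ℚ.<-≤-trans 0<1ℚ (fromℕ-mono {1} {suc n} (ℕ.s≤s ℕ.z≤n))

numerator-denominator : ∀ r → 0ℚ ℚ.≤ r → ∃₂ λ n d → r ℚ.* fromℕ (suc d) ≡ fromℕ n
numerator-denominator r@(mkℚ (ℤ.+ n) d _) _ = n , d , ℚ.toℚᵘ-injective
  (ℚᵘ.≃-trans (ℚ.toℚᵘ-homo-* r (fromℕ (suc d)))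
    (*≡* (trans (ℤ.*-identityʳ _) (cong (ℤ.+ n ℤ.*_) (cong (λ i → ℤ.+ suc i) (sym (ℕ.*-identityʳ d)))))))
numerator-denominator (mkℚ ℤ.-[1+ _ ] _ _) 0≤r with ℚ.drop-*≤* 0≤r
... | ()

iterate-+ : ∀ {A : Set} (f : A → A) x j k →
            iterate f x (j ℕ.+ k) ≡ iterate f (iterate f x k) j
iterate-+ f x j zero    = cong (iterate f x) (ℕ.+-identityʳ j)
iterate-+ f x j (suc k) = trans (cong (iterate f x) (ℕ.+-suc j k)) (iterate-+ f (f x) j k)

-- Membership in lower cuts

∈-fromℚ⁺ : ∀ {p q} → p ℚ.< q → p ∈ cut (fromℚ q)
∈-fromℚ⁺ {p} {q} = fromWitness {a? = p ℚ.<? q}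

∈-fromℚ⁻ : ∀ {p q} → p ∈ cut (fromℚ q) → p ℚ.< q
∈-fromℚ⁻ {p} {q} = toWitness {a? = p ℚ.<? q}

∉-fromℚ : ∀ {p q} → p ℚ.≤ q → q ∉ cut (fromℚ p)
∉-fromℚ p≤q q∈ = <⇒≱ (∈-fromℚ⁻ q∈) p≤q

∈-≤ : ∀ x {p q} → p ℚ.≤ q → q ∈ cut x → p ∈ cut x
∈-≤ x p≤q q∈ = let q′ , q<q′ , q′∈ = ℝ.rounded x q∈ in
  ℝ.downward x (ℚ.≤-<-trans p≤q q<q′) q′∈

∉-≤ : ∀ x {p q} → p ℚ.≤ q → p ∉ cut x → q ∉ cut x
∉-≤ x p≤q p∉ q∈ = p∉ (∈-≤ x p≤q q∈)

0ℝ<⇒∃nonNeg : ∀ x → 0ℝ < x → ∃[ q ] 0ℚ ℚ.≤ q × q ∈ cut x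
0ℝ<⇒∃nonNeg x (q , q∈ , q∉) = q , ℚ.≮⇒≥ (q∉ ∘ ∈-fromℚ⁺) , q∈

infix 4 _∈⦅_,_⟧
-- Half-open because a lower cut expresses exactly this: `a ∈ cut x` is a < x, and `b ∉ cut x` is x
-- ≤ b.
_∈⦅_,_⟧ : ℝ → ℚ → ℚ → Set
x ∈⦅ a , b ⟧ = a ∈ cut x × b ∉ cut x

module _ (em : ExcludedMiddle 0ℓ) where
  open Classical em

  -- Rational bounds for the real operations

  ∈-+ : ∀ x y {p q} → p ∈ cut x → q ∈ cut y → p ℚ.+ q ∈ cut (x + y)
  ∈-+ x y {p} {q} p∈ q∈ = let p′ , p<p′ , p′∈ = ℝ.rounded x p∈ in
    ∈-sup⁺ (p′ ℚ.+ q) (p′ , q , p′∈ , q∈ , refl) (ℚ.+-monoˡ-< q p<p′)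

  -- `v` itself is not in the cut of `fromℚ v`. Moving `p` up to some p′ still below `x` leaves room
  -- to lower `v` by p′ - p.
  ∈-+fromℚ⁺ : ∀ x v {p} → p ∈ cut x → p ℚ.+ v ∈ cut (x + fromℚ v)
  ∈-+fromℚ⁺ x v {p} p∈ = let p′ , p<p′ , p′∈ = ℝ.rounded x p∈ in
    subst (_∈ cut (x + fromℚ v))
      (solve 3 (λ p p′ v → p′ :+ (v :- (p′ :- p)) := p :+ v) refl p p′ v)
      (∈-+ x (fromℚ v) p′∈ (∈-fromℚ⁺ (<-slack (p′ ℚ.- p) (p<q⇒0<q-p p<p′)
        (solve 3 (λ p p′ v → (v :- (p′ :- p)) :+ (p′ :- p) := v) refl p p′ v))))

  ∈-+fromℚ⁻ : ∀ x v {q} → q ∈ cut (x + fromℚ v) → ∃[ p ] p ∈ cut x × q ℚ.< p ℚ.+ v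
  ∈-+fromℚ⁻ x v q∈ with ∈-sup⁻ q∈
  ... | _ , (p , w , p∈ , w∈ , refl) , q< =
    p , p∈ , ℚ.<-trans q< (ℚ.+-monoʳ-< p (∈-fromℚ⁻ w∈))

  ∈-· : ∀ n x {p} → p ∈ cut x → fromℕ (suc n) ℚ.* p ∈ cut (suc n · x)
  ∈-· n x p∈ = let p′ , p<p′ , p′∈ = ℝ.rounded x p∈ in
    ∈-sup⁺ _ (p′ , p′∈ , refl) (*-monoʳ-< (0<fromℕ-suc n) p<p′)

  ∉-· : ∀ n x {p} → p ∉ cut x → fromℕ n ℚ.* p ∉ cut (n · x)
  ∉-· n x p∉ np∈ with ∈-sup⁻ np∈
  ... | _ , (p′ , p′∈ , refl) , np< =
    <⇒≱ np< (*-monoʳ-≤ (0≤fromℕ n) (∈∉⇒≤ x p′∈ p∉))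

  ∉-+fromℚ : ∀ x v {p} → p ∉ cut x → p ℚ.+ v ∉ cut (x + fromℚ v)
  ∉-+fromℚ x v p∉ p+v∈ = let p′ , p′∈ , lt = ∈-+fromℚ⁻ x v p+v∈ in
    <⇒≱ lt (ℚ.+-monoˡ-≤ v (∈∉⇒≤ x p′∈ p∉))

  ∈-recip : ∀ x 0<x {u q} → 0ℚ ℚ.< u → u ∉ cut x → q ℚ.* u ℚ.< 1ℚ → q ∈ cut (recip x 0<x)
  ∈-recip x 0<x {u} {q} 0<u u∉ qu<1 = let ρ , 0<ρ , uρ≡1 = inverse 0<u in
    ∈-sup⁺ ρ (u , u∉ , ℚ.≤-reflexive (trans (ℚ.*-comm ρ u) uρ≡1))
      (*-cancelˡ-< (ℚ.<⇒≤ 0<u) (subst₂ ℚ._<_ (ℚ.*-comm q u) (sym uρ≡1) qu<1))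

  -- A witness `g` for 1/x has g r ≤ 1 for some r ≥ x. If c < g, then g r ≥ g a′ > g a ≥ c a ≥ 1 for
  -- a rational a′ with a < a′ < x.
  recip-≤ : ∀ x 0<x {a c} → 0ℚ ℚ.≤ a → a ∈ cut x → 1ℚ ℚ.≤ c ℚ.* a →
            recip x 0<x ≤ fromℚ c
  recip-≤ x 0<x {a} {c} 0≤a a∈ 1≤ca q q∈ with ∈-sup⁻ q∈ | ℝ.rounded x a∈
  ... | g , (r , r∉ , gr≤1) , q<g | a′ , a<a′ , a′∈ = ∈-fromℚ⁺ (ℚ.<-≤-trans q<g (ℚ.≮⇒≥ λ c<g →
    ℚ.<-irrefl refl (begin-strict
      1ℚ         ≤⟨ 1≤ca ⟩
      c ℚ.* a    ≤⟨ ℚ.*-monoʳ-≤-nonNeg a {{ℚ.nonNegative 0≤a}} (ℚ.<⇒≤ c<g) ⟩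
      g ℚ.* a    <⟨ *-monoʳ-< (0<g c<g) a<a′ ⟩
      g ℚ.* a′   ≤⟨ *-monoʳ-≤ (ℚ.<⇒≤ (0<g c<g)) (∈∉⇒≤ x a′∈ r∉) ⟩
      g ℚ.* r    ≤⟨ gr≤1 ⟩
      1ℚ         ∎)))
    where
    open ℚ.≤-Reasoning
    -- The bound g r ≤ 1 says nothing about the sign of `g`; it comes from a g ≥ a c ≥ 1 with a ≥ 0.
    0<g : c ℚ.< g → 0ℚ ℚ.< g
    0<g c<g = *-cancelˡ-< 0≤a (begin-strict
      a ℚ.* 0ℚ  ≡⟨ ℚ.*-zeroʳ a ⟩
      0ℚ        <⟨ 0<1ℚ ⟩
      1ℚ        ≤⟨ 1≤ca ⟩
      c ℚ.* a   ≡⟨ ℚ.*-comm c a ⟩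
      a ℚ.* c   ≤⟨ *-monoʳ-≤ 0≤a (ℚ.<⇒≤ c<g) ⟩
      a ℚ.* g   ∎)

  ⌈⌉-unique : ∀ x e → fromℕ e ∈ cut x → x ≤ fromℚ (fromℕ (suc e)) → ⌈ x ⌉ ≡ suc e
  ⌈⌉-unique x e e∈ x≤1+e =
    let n , x≤n , n-min = least (λ n → x ≤ fromℚ (fromℕ n)) _ (proj₂ (natBound x)) in
    ℕ.≤-antisym (n-min (suc e) x≤1+e)
      (ℕ.≰⇒> λ n≤e → <⇒≱ (∈-fromℚ⁻ (x≤n _ e∈)) (fromℕ-mono n≤e))

  -- The affine branches of `T`

  -- (a, b] ⊆ [1/(e+1), 1/e), the points with first digit e + 1.
  record Branch (e : ℕ) (a b : ℚ) : Set where
    constructor branch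
    field
      1≤[1+e]a : 1ℚ ℚ.≤ fromℕ (suc e) ℚ.* a
      eb<1     : fromℕ e ℚ.* b ℚ.< 1ℚ

  module _ {e a b y} (B : Branch e a b) (y∈ : y ∈⦅ a , b ⟧) where
    open Branch B

    private
      c : ℚ
      c = fromℕ (suc e)

      0<a : 0ℚ ℚ.< a
      0<a = *-cancelˡ-< (0≤fromℕ (suc e))
        (subst (ℚ._< c ℚ.* a) (sym (ℚ.*-zeroʳ c)) (ℚ.<-≤-trans 0<1ℚ 1≤[1+e]a))

      0<y : 0ℝ < y
      0<y = a , proj₁ y∈ , ℚ.<-asym 0<a ∘ ∈-fromℚ⁻

      ⌈1/y⌉ : ∀ 0<y → ⌈ recip y 0<y ⌉ ≡ suc e
      ⌈1/y⌉ 0<y = ⌈⌉-unique _ e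
        (∈-recip y 0<y (ℚ.<-≤-trans 0<a (∈∉⇒≤ y (proj₁ y∈) (proj₂ y∈))) (proj₂ y∈) eb<1)
        (recip-≤ y 0<y (ℚ.<⇒≤ 0<a) (proj₁ y∈) 1≤[1+e]a)

      -- The decision is a variable because `em` is a hypothesis and does not reduce. For the same
      -- reason `⌈1/y⌉` holds for every proof of 0 < y.
      engelDigit-branch : ∀ 0<y? → engelDigit y 0<y? ≡ just (suc e)
      engelDigit-branch (yes 0<y) = cong just (⌈1/y⌉ 0<y)
      engelDigit-branch (no 0≮y)  = ⊥-elim (0≮y 0<y)

      affine-bounds : ∀ {n} → n ≡ suc e →
                      n · y + fromℚ (ℚ.- 1ℚ) ∈⦅ c ℚ.* a ℚ.- 1ℚ , c ℚ.* b ℚ.- 1ℚ ⟧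
      affine-bounds refl =
        ∈-+fromℚ⁺ (suc e · y) (ℚ.- 1ℚ) (∈-· e y (proj₁ y∈)) ,
        ∉-+fromℚ (suc e · y) (ℚ.- 1ℚ) (∉-· (suc e) y (proj₂ y∈))

      engelMap-branch : ∀ 0<y? → engelMap y 0<y? ∈⦅ c ℚ.* a ℚ.- 1ℚ , c ℚ.* b ℚ.- 1ℚ ⟧
      engelMap-branch (yes 0<y) = affine-bounds (⌈1/y⌉ 0<y)
      engelMap-branch (no 0≮y)  = ⊥-elim (0≮y 0<y)

    firstDigit-branch : firstDigit y ≡ just (suc e)
    firstDigit-branch = engelDigit-branch em

    T-branch : T y ∈⦅ c ℚ.* a ℚ.- 1ℚ , c ℚ.* b ℚ.- 1ℚ ⟧
    T-branch = engelMap-branch em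

  -- Orbits of rationals

  -- Some iterate of T sends r to 0 and expands the right neighbourhood
  -- [r, r + δ] linearly by the factor D.
  record Vanishing (r : ℚ) : Set where
    field
      time      : ℕ
      D δ       : ℚ
      D-pos     : 0ℚ ℚ.< D
      δ-pos     : 0ℚ ℚ.< δ
      expansion : ∀ y {ε₁ ε₂} → 0ℚ ℚ.≤ ε₁ → ε₂ ℚ.≤ δ → y ∈⦅ r ℚ.+ ε₁ , r ℚ.+ ε₂ ⟧ →
                  iterate T y time ∈⦅ D ℚ.* ε₁ , D ℚ.* ε₂ ⟧

  ∈⦅⟧-cong : ∀ {x a a′ b b′} → a ≡ a′ → b ≡ b′ → x ∈⦅ a , b ⟧ → x ∈⦅ a′ , b′ ⟧
  ∈⦅⟧-cong refl refl x∈ = x∈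

  -- T r = ((e + 1) n − q) / q again has denominator q, with a smaller numerator.
  engel-step : ∀ q m → ∃₂ λ e n′ → e ℕ.* suc m ℕ.≤ q ×
               suc e ℕ.* suc m ≡ n′ ℕ.+ suc q × n′ ℕ.< suc m
  engel-step q m = e , n′ , en≤q , sym n′+q≡ ,
    ℕ.+-cancelʳ-< (suc q) n′ (suc m) (subst (ℕ._< suc m ℕ.+ suc q) (sym n′+q≡)
      (ℕ.+-monoʳ-< (suc m) (ℕ.s≤s en≤q)))
    where
    e n′ : ℕ
    -- With numerator n = `suc m` and denominator Q = `suc q`, ⌊(Q - 1)/n⌋ = ⌈Q/n⌉ - 1, so `suc e`
    -- is the Engel digit of n/Q.
    e  = q ℕ./ suc m
    n′ = suc e ℕ.* suc m ℕ.∸ suc q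
    en≤q : e ℕ.* suc m ℕ.≤ q
    en≤q = ℕ.m/n*n≤m q (suc m)
    q<[1+e]n : q ℕ.< suc e ℕ.* suc m
    q<[1+e]n = subst (ℕ._< suc e ℕ.* suc m) (sym (ℕ.m≡m%n+[m/n]*n q (suc m)))
      (ℕ.+-monoˡ-< (e ℕ.* suc m) (ℕ.m%n<n q (suc m)))
    n′+q≡ : n′ ℕ.+ suc q ≡ suc e ℕ.* suc m
    n′+q≡ = ℕ.m∸n+n≡m q<[1+e]n

  vanishing-zero : ∀ {r} → r ≡ 0ℚ → Vanishing r
  vanishing-zero refl = record
    { time = 0 ; D = 1ℚ ; δ = 1ℚ ; D-pos = 0<1ℚ ; δ-pos = 0<1ℚ
    ; expansion = λ y {ε₁} {ε₂} _ _ → ∈⦅⟧-cong {x = y} (0+≡1* ε₁) (0+≡1* ε₂)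
    }
    where
    0+≡1* : ∀ ε → 0ℚ ℚ.+ ε ≡ 1ℚ ℚ.* ε
    0+≡1* ε = trans (ℚ.+-identityˡ ε) (sym (ℚ.*-identityˡ ε))

  -- On the branch of `r` the map `T` has slope e + 1, so an offset ε from `r` becomes an offset (e
  -- + 1) ε from the image of `r`, and the expansion factors multiply.
  vanishing-suc : ∀ {r} e → fromℕ e ℚ.* r ℚ.< 1ℚ → 1ℚ ℚ.≤ fromℕ (suc e) ℚ.* r →
                  Vanishing (fromℕ (suc e) ℚ.* r ℚ.- 1ℚ) → Vanishing r
  vanishing-suc {r} e er<1 1≤[1+e]r V = record
    { time      = suc V.time
    ; D         = V.D ℚ.* C
    ; δ         = κ ℚ.* μ
    ; D-pos     = *-pos V.D-pos (0<fromℕ-suc e)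
    ; δ-pos     = 0<κμ
    ; expansion = λ y {ε₁} {ε₂} 0≤ε₁ ε₂≤δ y∈ →
        ∈⦅⟧-cong {x = iterate T (T y) V.time}
          (sym (ℚ.*-assoc V.D C ε₁)) (sym (ℚ.*-assoc V.D C ε₂))
          (V.expansion (T y) (*-nonNeg (0≤fromℕ (suc e)) 0≤ε₁) (Cε≤δ′ ε₂≤δ)
            (∈⦅⟧-cong {x = T y} (affine C r ε₁) (affine C r ε₂)
              (T-branch {y = y} (branch (1≤C[r+ε] 0≤ε₁) (E[r+ε]<1 ε₂≤δ)) y∈)))
    }
    where
    module V = Vanishing V
    C E μ κ : ℚ
    C = fromℕ (suc e)
    E = fromℕ e
    -- Two constraints on C ε: the image must stay within the radius of the later expansion, and E
    -- (r + ε) must stay below 1. The new radius is μ/C.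
    μ = V.δ ℚ.⊓ (1ℚ ℚ.- E ℚ.* r)
    κ = proj₁ (inverse (0<fromℕ-suc e))
    0<κ : 0ℚ ℚ.< κ
    0<κ = proj₁ (proj₂ (inverse (0<fromℕ-suc e)))
    0<κμ : 0ℚ ℚ.< κ ℚ.* μ
    0<κμ = *-pos 0<κ (⊓-pos V.δ-pos (p<q⇒0<q-p er<1))
    Cκμ≡μ : C ℚ.* (κ ℚ.* μ) ≡ μ
    Cκμ≡μ = trans (sym (ℚ.*-assoc C κ μ))
      (trans (cong (ℚ._* μ) (proj₂ (proj₂ (inverse (0<fromℕ-suc e))))) (ℚ.*-identityˡ μ))
    C≡1+E : C ≡ 1ℚ ℚ.+ E
    C≡1+E = fromℕ-+ 1 e
    affine : ∀ C r ε → C ℚ.* (r ℚ.+ ε) ℚ.- 1ℚ ≡ C ℚ.* r ℚ.- 1ℚ ℚ.+ C ℚ.* ε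
    affine = solve 3 (λ C r ε → C :* (r :+ ε) :- con 1ℚ := C :* r :- con 1ℚ :+ C :* ε) refl
    open ℚ.≤-Reasoning
    Cε≤δ′ : ∀ {ε} → ε ℚ.≤ κ ℚ.* μ → C ℚ.* ε ℚ.≤ V.δ
    Cε≤δ′ {ε} ε≤ = begin
      C ℚ.* ε            ≤⟨ *-monoʳ-≤ (0≤fromℕ (suc e)) ε≤ ⟩
      C ℚ.* (κ ℚ.* μ)    ≡⟨ Cκμ≡μ ⟩
      μ                  ≤⟨ ℚ.p⊓q≤p V.δ (1ℚ ℚ.- E ℚ.* r) ⟩
      V.δ                ∎
    1≤C[r+ε] : ∀ {ε} → 0ℚ ℚ.≤ ε → 1ℚ ℚ.≤ C ℚ.* (r ℚ.+ ε)
    1≤C[r+ε] {ε} 0≤ε = ℚ.≤-trans 1≤[1+e]r (*-monoʳ-≤ {p = r} (0≤fromℕ (suc e)) (≤-slack ε 0≤ε refl))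
    E[r+ε]<1 : ∀ {ε} → ε ℚ.≤ κ ℚ.* μ → E ℚ.* (r ℚ.+ ε) ℚ.< 1ℚ
    E[r+ε]<1 {ε} ε≤ = begin-strict
      E ℚ.* (r ℚ.+ ε)                   ≡⟨ ℚ.*-distribˡ-+ E r ε ⟩
      E ℚ.* r ℚ.+ E ℚ.* ε               ≤⟨ ℚ.+-monoʳ-≤ (E ℚ.* r) (*-monoʳ-≤ (0≤fromℕ e) ε≤) ⟩
      -- Strictness comes from `E` < `C`, since ε may equal the radius.
      E ℚ.* r ℚ.+ E ℚ.* (κ ℚ.* μ)       <⟨ ℚ.+-monoʳ-< (E ℚ.* r) (<-slack (κ ℚ.* μ) 0<κμ
                                             (trans (Eδ+δ E (κ ℚ.* μ)) (cong (ℚ._* (κ ℚ.* μ)) (sym C≡1+E)))) ⟩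
      E ℚ.* r ℚ.+ C ℚ.* (κ ℚ.* μ)       ≡⟨ cong (E ℚ.* r ℚ.+_) Cκμ≡μ ⟩
      E ℚ.* r ℚ.+ μ                     ≤⟨ ℚ.+-monoʳ-≤ (E ℚ.* r) (ℚ.p⊓q≤q V.δ (1ℚ ℚ.- E ℚ.* r)) ⟩
      E ℚ.* r ℚ.+ (1ℚ ℚ.- E ℚ.* r)      ≡⟨ solve 1 (λ z → z :+ (con 1ℚ :- z) := con 1ℚ) refl (E ℚ.* r) ⟩
      1ℚ                                ∎
      where
      Eδ+δ : ∀ E δ → E ℚ.* δ ℚ.+ δ ≡ (1ℚ ℚ.+ E) ℚ.* δ
      Eδ+δ = solve 2 (λ E δ → E :* δ :+ δ := (con 1ℚ :+ E) :* δ) refl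

  -- Descent on the numerator `n` with the denominator `suc q` fixed. The equation is carried along
  -- because the successive fractions need not be in lowest terms.
  vanishing-acc : ∀ q {n} → Acc ℕ._<_ n → ∀ r → r ℚ.* fromℕ (suc q) ≡ fromℕ n → Vanishing r
  vanishing-acc q {zero} _ r rQ≡0 = vanishing-zero (begin
    r                                ≡⟨ ℚ.*-identityʳ r ⟨
    r ℚ.* 1ℚ                         ≡⟨ cong (r ℚ.*_) Qρ≡1 ⟨
    r ℚ.* (fromℕ (suc q) ℚ.* ρ)      ≡⟨ ℚ.*-assoc r (fromℕ (suc q)) ρ ⟨
    r ℚ.* fromℕ (suc q) ℚ.* ρ        ≡⟨ cong (ℚ._* ρ) rQ≡0 ⟩
    0ℚ ℚ.* ρ                         ≡⟨ ℚ.*-zeroˡ ρ ⟩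
    0ℚ                               ∎)
    where
    open ≡-Reasoning
    ρ : ℚ
    ρ = proj₁ (inverse (0<fromℕ-suc q))
    Qρ≡1 : fromℕ (suc q) ℚ.* ρ ≡ 1ℚ
    Qρ≡1 = proj₂ (proj₂ (inverse (0<fromℕ-suc q)))
  vanishing-acc q {suc m} (acc rs) r rQ≡n =
    let e , n′ , en≤q , [1+e]n≡ , n′<n = engel-step q m in
    vanishing-suc e
      (*-cancelˡ-< (0≤fromℕ (suc q)) (subst₂ ℚ._<_ (scaled e) (sym (ℚ.*-identityʳ Q))
        (ℚ.≤-<-trans (fromℕ-mono en≤q) fromℕ-q<Q)))
      (ℚ.*-cancelˡ-≤-pos Q {{ℚ.positive (0<fromℕ-suc q)}}
        (subst₂ ℚ._≤_ (sym (ℚ.*-identityʳ Q)) (scaled (suc e))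
          (fromℕ-mono (subst (suc q ℕ.≤_) (sym [1+e]n≡) (ℕ.m≤n+m (suc q) n′)))))
      (vanishing-acc q (rs n′<n) _ (reduced e n′ [1+e]n≡))
    where
    Q : ℚ
    Q = fromℕ (suc q)
    fromℕ-q<Q : fromℕ q ℚ.< Q
    fromℕ-q<Q = <-slack 1ℚ 0<1ℚ (trans (ℚ.+-comm (fromℕ q) 1ℚ) (sym (fromℕ-+ 1 q)))
    scaled : ∀ k → fromℕ (k ℕ.* suc m) ≡ Q ℚ.* (fromℕ k ℚ.* r)
    scaled k = trans (fromℕ-* k (suc m)) (trans (cong (fromℕ k ℚ.*_) (sym rQ≡n))
      (solve 3 (λ K r Q → K :* (r :* Q) := Q :* (K :* r)) refl (fromℕ k) r Q))
    reduced : ∀ e n′ → suc e ℕ.* suc m ≡ n′ ℕ.+ suc q →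
              (fromℕ (suc e) ℚ.* r ℚ.- 1ℚ) ℚ.* Q ≡ fromℕ n′
    reduced e n′ eq =
      trans (solve 3 (λ C r Q → (C :* r :- con 1ℚ) :* Q := Q :* (C :* r) :- Q) refl (fromℕ (suc e)) r Q)
      (trans (cong (ℚ._- Q) (trans (sym (scaled (suc e))) (trans (cong fromℕ eq) (fromℕ-+ n′ (suc q)))))
        (solve 2 (λ N Q → N :+ Q :- Q := N) refl (fromℕ n′) Q))

  vanishing : ∀ r → 0ℚ ℚ.≤ r → Vanishing r
  vanishing r 0≤r = let n , d , eq = numerator-denominator r 0≤r in
    vanishing-acc d (<-wellFounded n) r eq

  -- Long runs of one digit

  -- Near the fixed point 1/e of x ↦ (e + 1) x − 1 the digit e + 1 repeats.
  repeating-block : ∀ e K → ∃₂ λ u v → 0ℚ ℚ.≤ u × u ℚ.< v × fromℕ e ℚ.* v ℚ.< 1ℚ ×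
    (∀ y → y ∈⦅ u , v ⟧ → ∀ j → j ℕ.< K → digit y j ≡ just (suc e))
  -- For an empty run, (0, 1/(e + 1)] will do: its right end satisfies e/(e + 1) = 1 - 1/(e + 1) <
  -- 1.
  repeating-block e zero = let κ , 0<κ , Cκ≡1 = inverse (0<fromℕ-suc e) in
    0ℚ , κ , ℚ.≤-refl , 0<κ ,
    <-slack κ 0<κ (trans (solve 2 (λ E κ → E :* κ :+ κ := (con 1ℚ :+ E) :* κ) refl (fromℕ e) κ)
      (trans (cong (ℚ._* κ) (sym (fromℕ-+ 1 e))) Cκ≡1)) ,
    λ _ _ _ ()
  repeating-block e (suc K) with repeating-block e K | inverse (0<fromℕ-suc e)
  ... | u , v , 0≤u , u<v , ev<1 , block | κ , 0<κ , Cκ≡1 =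
    -- The inverse branch w ↦ (1 + w)/(e + 1) pulls the interval back by one digit and preserves the
    -- condition e v < 1.
    κ ℚ.* (1ℚ ℚ.+ u) , κ ℚ.* (1ℚ ℚ.+ v) ,
    *-nonNeg (ℚ.<⇒≤ 0<κ) (ℚ.+-mono-≤ (ℚ.<⇒≤ 0<1ℚ) 0≤u) ,
    *-monoʳ-< 0<κ (ℚ.+-monoʳ-< 1ℚ u<v) ,
    Branch.eb<1 B , digits
    where
    E C : ℚ
    E = fromℕ e
    C = fromℕ (suc e)
    Cκ[1+_] : ∀ w → C ℚ.* (κ ℚ.* (1ℚ ℚ.+ w)) ≡ 1ℚ ℚ.+ w
    Cκ[1+ w ] = trans (sym (ℚ.*-assoc C κ (1ℚ ℚ.+ w)))
      (trans (cong (ℚ._* (1ℚ ℚ.+ w)) Cκ≡1) (ℚ.*-identityˡ (1ℚ ℚ.+ w)))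
    inverse-branch : ∀ w → C ℚ.* (κ ℚ.* (1ℚ ℚ.+ w)) ℚ.- 1ℚ ≡ w
    inverse-branch w = trans (cong (ℚ._- 1ℚ) Cκ[1+ w ])
      (solve 1 (λ w → con 1ℚ :+ w :- con 1ℚ := w) refl w)
    B : Branch e (κ ℚ.* (1ℚ ℚ.+ u)) (κ ℚ.* (1ℚ ℚ.+ v))
    B = branch (≤-slack u 0≤u (sym Cκ[1+ u ])) (begin-strict
      E ℚ.* (κ ℚ.* (1ℚ ℚ.+ v))    ≡⟨ solve 3 (λ E κ v → E :* (κ :* (con 1ℚ :+ v)) := κ :* (E :* v :+ E)) refl E κ v ⟩
      κ ℚ.* (E ℚ.* v ℚ.+ E)       <⟨ *-monoʳ-< 0<κ (ℚ.+-monoˡ-< E ev<1) ⟩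
      κ ℚ.* (1ℚ ℚ.+ E)            ≡⟨ cong (κ ℚ.*_) (fromℕ-+ 1 e) ⟨
      κ ℚ.* C                     ≡⟨ ℚ.*-comm κ C ⟩
      C ℚ.* κ                     ≡⟨ Cκ≡1 ⟩
      1ℚ                          ∎)
      where open ℚ.≤-Reasoning
    digits : ∀ y → y ∈⦅ κ ℚ.* (1ℚ ℚ.+ u) , κ ℚ.* (1ℚ ℚ.+ v) ⟧ →
             ∀ j → j ℕ.< suc K → digit y j ≡ just (suc e)
    digits y y∈ zero    _           = firstDigit-branch {y = y} B y∈
    digits y y∈ (suc j) (ℕ.s≤s j<K) = block (T y)
      (∈⦅⟧-cong {x = T y} (inverse-branch u) (inverse-branch v) (T-branch {y = y} B y∈)) j j<K

  -- The length `L` is a function of `e` because `e` can be chosen only once the expansion at `r` is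
  -- known. The block near 1/e is then pulled back through that expansion.
  dense-block : ∀ (L : ℕ → ℕ) {r R} → 0ℚ ℚ.≤ r → r ℚ.< R →
    ∃₂ λ p q → r ℚ.≤ p × p ℚ.< q × q ℚ.≤ R × ∃₂ λ k e →
      ∀ y → y ∈⦅ p , q ⟧ → ∀ j → j ℕ.< L e → digit y (j ℕ.+ k) ≡ just (suc e)
  dense-block L {r} {R} 0≤r r<R =
    r ℚ.+ κ ℚ.* u , r ℚ.+ κ ℚ.* v ,
    ≤-slack (κ ℚ.* u) 0≤κu refl ,
    ℚ.+-monoʳ-< r (*-monoʳ-< 0<κ u<v) ,
    subst (r ℚ.+ κ ℚ.* v ℚ.≤_) (solve 2 (λ r R → r :+ (R :- r) := R) refl r R)
      (ℚ.+-monoʳ-≤ r (ℚ.≤-trans κv≤ (ℚ.p⊓q≤q V.δ (R ℚ.- r)))) ,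
    V.time , e ,
    λ y y∈ j j<L → trans (cong firstDigit (iterate-+ T y j V.time))
      (block (iterate T y V.time)
        (∈⦅⟧-cong {x = iterate T y V.time} Dκ[ u ] Dκ[ v ]
          (V.expansion y 0≤κu (ℚ.≤-trans κv≤ (ℚ.p⊓q≤p V.δ (R ℚ.- r))) y∈))
        j j<L)
    where
    module V = Vanishing (vanishing r 0≤r)
    η μ κ σ : ℚ
    -- Offsets up to `η` stay within the radius of the expansion and do not pass `R`; `μ` is the
    -- offset `η` after expansion.
    η = V.δ ℚ.⊓ (R ℚ.- r)
    μ = V.D ℚ.* η
    0<μ : 0ℚ ℚ.< μ
    0<μ = *-pos V.D-pos (⊓-pos V.δ-pos (p<q⇒0<q-p r<R))
    κ = proj₁ (inverse V.D-pos)
    0<κ : 0ℚ ℚ.< κ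
    0<κ = proj₁ (proj₂ (inverse V.D-pos))
    Dκ[_] : ∀ w → V.D ℚ.* (κ ℚ.* w) ≡ w
    Dκ[ w ] = trans (sym (ℚ.*-assoc V.D κ w))
      (trans (cong (ℚ._* w) (proj₂ (proj₂ (inverse V.D-pos)))) (ℚ.*-identityˡ w))
    σ = proj₁ (inverse 0<μ)
    -- Here e ≥ 1/μ, so e v < 1 ≤ e μ forces v < μ and the block fits inside (0, μ].
    e : ℕ
    e = proj₁ (archimedean σ)
    1≤eμ : 1ℚ ℚ.≤ fromℕ e ℚ.* μ
    1≤eμ = subst₂ ℚ._≤_ (proj₂ (proj₂ (inverse 0<μ))) (ℚ.*-comm μ (fromℕ e))
      (*-monoʳ-≤ (ℚ.<⇒≤ 0<μ) (proj₂ (archimedean σ)))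
    run = repeating-block e (L e)
    u v : ℚ
    u = proj₁ run
    v = proj₁ (proj₂ run)
    0≤u : 0ℚ ℚ.≤ u
    0≤u = proj₁ (proj₂ (proj₂ run))
    u<v : u ℚ.< v
    u<v = proj₁ (proj₂ (proj₂ (proj₂ run)))
    ev<1 : fromℕ e ℚ.* v ℚ.< 1ℚ
    ev<1 = proj₁ (proj₂ (proj₂ (proj₂ (proj₂ run))))
    block : ∀ y → y ∈⦅ u , v ⟧ → ∀ j → j ℕ.< L e → digit y j ≡ just (suc e)
    block = proj₂ (proj₂ (proj₂ (proj₂ (proj₂ run))))
    0≤κu : 0ℚ ℚ.≤ κ ℚ.* u
    0≤κu = *-nonNeg (ℚ.<⇒≤ 0<κ) 0≤u
    κv≤ : κ ℚ.* v ℚ.≤ η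
    κv≤ = ℚ.<⇒≤ (*-cancelˡ-< (ℚ.<⇒≤ V.D-pos) (subst (ℚ._< μ) (sym Dκ[ v ])
      (*-cancelˡ-< (0≤fromℕ e) (ℚ.<-≤-trans ev<1 1≤eμ))))

  -- Nowhere density from rational intervals

  rational-subinterval : ∀ x {a b} → x ∈⟨ a , b ⟩ →
    ∃₂ λ r R → 0ℚ ℚ.≤ r × r ℚ.< R × R ℚ.≤ 1ℚ × r ∉ cut a × R ∈ cut b
  rational-subinterval x {a} {b} ((q₁ , q₁∈x , q₁∉a) , (q₂ , q₂∈b , q₂∉x)) =
    let q₀ , 0≤q₀ , q₀∈x = 0ℝ<⇒∃nonNeg (value x) (𝕀.0< x)
        q₃ , q₃∈1 , q₃∉x = 𝕀.<1 x
        r∈x = case-⊔ q₀∈x q₁∈x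
        r′ , r<r′ , r′∈x = ℝ.rounded (value x) r∈x
    -- `q₀` and `q₃` clip the interval to [0,1]; `x` still separates the two ends.
    in q₀ ℚ.⊔ q₁ , q₂ ℚ.⊓ q₃ ,
       ℚ.≤-trans 0≤q₀ (ℚ.p≤p⊔q q₀ q₁) ,
       ℚ.<-≤-trans r<r′ (∈∉⇒≤ (value x) r′∈x (case-⊓ q₂∉x q₃∉x)) ,
       ℚ.≤-trans (ℚ.p⊓q≤q q₂ q₃) (ℚ.<⇒≤ (∈-fromℚ⁻ q₃∈1)) ,
       ∉-≤ a (ℚ.p≤q⊔p q₀ q₁) q₁∉a ,
       ∈-≤ b (ℚ.p⊓q≤p q₂ q₃) q₂∈b
    where
    case-⊔ : ∀ {p q} → p ∈ cut (value x) → q ∈ cut (value x) → p ℚ.⊔ q ∈ cut (value x)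
    case-⊔ {p} {q} p∈ q∈ with ℚ.⊔-sel p q
    ... | inj₁ eq = subst (_∈ cut (value x)) (sym eq) p∈
    ... | inj₂ eq = subst (_∈ cut (value x)) (sym eq) q∈
    case-⊓ : ∀ {p q} → p ∉ cut (value x) → q ∉ cut (value x) → p ℚ.⊓ q ∉ cut (value x)
    case-⊓ {p} {q} p∉ q∉ with ℚ.⊓-sel p q
    ... | inj₁ eq = subst (_∉ cut (value x)) (sym eq) p∉
    ... | inj₂ eq = subst (_∉ cut (value x)) (sym eq) q∉

  -- If the closure contained an interval, it would contain a rational m strictly inside the
  -- avoiding subinterval (p, q). Then `A` would meet (p, q).
  nowhereDense : ∀ {A} →
    (∀ {r R} → 0ℚ ℚ.≤ r → r ℚ.< R →
      ∃₂ λ p q → r ℚ.≤ p × p ℚ.< q × q ℚ.≤ R × (∀ y → value y ∈⦅ p , q ⟧ → y ∉ A)) →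
    NowhereDense A
  nowhereDense {A} avoid x (a , b , x∈ , ⊆closure) =
    let r , R , 0≤r , r<R , R≤1 , r∉a , R∈b = rational-subinterval x {a} {b} x∈
        p , q , r≤p , p<q , q≤R , avoids = avoid 0≤r r<R
        m , p<m , m<q = ℚ.<-dense p<q
        r<m = ℚ.≤-<-trans r≤p p<m
        m<R = ℚ.<-≤-trans m<q q≤R
        y = record
          { value = fromℚ m
          ; 0<    = r , ∈-fromℚ⁺ r<m , ∉-fromℚ 0≤r
          ; <1    = m , ∈-fromℚ⁺ (ℚ.<-≤-trans m<R R≤1) , ∉-fromℚ ℚ.≤-refl
          }
        z , (p<z , z<q) , z∈A = ⊆closure y
          ((r , ∈-fromℚ⁺ r<m , r∉a) , (R , R∈b , ∉-fromℚ (ℚ.<⇒≤ m<R)))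
          (fromℚ p) (fromℚ q)
          ((p , ∈-fromℚ⁺ p<m , ∉-fromℚ ℚ.≤-refl) , (m , ∈-fromℚ⁺ m<q , ∉-fromℚ ℚ.≤-refl))
        s , s∈z , s∉p = p<z
        t , t∈q , t∉z = z<q
    in avoids z (∈-≤ (value z) (ℚ.≮⇒≥ (s∉p ∘ ∈-fromℚ⁺)) s∈z ,
                 ∉-≤ (value z) (ℚ.<⇒≤ (∈-fromℚ⁻ t∈q)) t∉z) z∈A

  -- The exceptional sets

  -- The M-th exceptional set excludes runs of a digit d = e + 1 that are long
  -- enough for their terms d⁻ˢ, s ≤ M, beyond index M to sum to at least 2.
  runLength : ℕ → ℕ → ℕ
  runLength M e = proj₁ (archimedean (fromℕ 4 ℚ.* fromℕ (suc (suc e)) ^ℚ M))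

  ShortRuns : ℕ → Pred 𝕀 0ℓ
  ShortRuns M x = ∀ k e →
    ¬ (∀ j → j ℕ.< M ℕ.+ runLength M e → digit (value x) (j ℕ.+ k) ≡ just (suc e))

  nowhereDense-ShortRuns : ∀ M {A} → NowhereDense (A ∩ ShortRuns M)
  nowhereDense-ShortRuns M = nowhereDense λ 0≤r r<R →
    let p , q , r≤p , p<q , q≤R , k , e , block = dense-block (λ e → M ℕ.+ runLength M e) 0≤r r<R
    in p , q , r≤p , p<q , q≤R , λ y y∈ y∈A → proj₂ y∈A k e (block (value y) y∈)

  -- Convergent series and runs of equal digits

  opaque
    unfolding powerBound

    -- The exponent must be independent of `d`, as a single `M` has to serve all digits. Unfolding
    -- `powerBound` exposes its bound as a power of d + 1 whose exponent is a natural upper bound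
    -- for `s`.
    power∌ : ∀ s 0≤s → ∃[ m ] ∀ d → fromℕ (suc d) ^ℚ m ∉ cut (power d s 0≤s)
    power∌ s 0≤s = proj₁ (archimedean (proj₁ (ℝ.bounded s))) , λ d u∈ →
      let e , e∈ , u<e = ∈-sup⁻ u∈ in <⇒≱ u<e (proj₂ (powerBound d s) e e∈)

  ∈-∑< : ∀ f n j {p q} → p ∈ cut (∑< n f) → (∀ i → i ℕ.< j → q ∈ cut (f (i ℕ.+ n))) →
         p ℚ.+ fromℕ j ℚ.* q ∈ cut (∑< (j ℕ.+ n) f)
  ∈-∑< f n zero    {p} {q} p∈ _  = subst (_∈ cut (∑< n f))
    (sym (trans (cong (p ℚ.+_) (ℚ.*-zeroˡ q)) (ℚ.+-identityʳ p))) p∈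
  ∈-∑< f n (suc j) {p} {q} p∈ q∈ = subst (_∈ cut (∑< (j ℕ.+ n) f + f (j ℕ.+ n)))
    (trans (solve 3 (λ p q J → p :+ J :* q :+ q := p :+ (con 1ℚ :+ J) :* q) refl p q (fromℕ j))
      (cong (λ J → p ℚ.+ J ℚ.* q) (sym (fromℕ-+ 1 j))))
    (∈-+ (∑< (j ℕ.+ n) f) (f (j ℕ.+ n))
      (∈-∑< f n j p∈ (λ i i<j → q∈ i (ℕ.m<n⇒m<1+n i<j))) (q∈ j ℕ.≤-refl))

  -- Cauchy criterion with ε = 1: two partial sums past `N` differ by less than 2, whereas `j` terms
  -- all above `q` would add at least j q ≥ 2.
  converges⇒short-blocks : ∀ f → SeriesConverges f → ∃[ N ] ∀ n j q → N ℕ.≤ n →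
    fromℕ 2 ℚ.≤ fromℕ j ℚ.* q → ¬ (∀ i → i ℕ.< j → q ∈ cut (f (i ℕ.+ n)))
  converges⇒short-blocks f (S , lim) with lim 1ℝ (0ℚ , ∈-fromℚ⁺ {0ℚ} {1ℚ} 0<1ℚ , ∉-fromℚ {0ℚ} {0ℚ} ℚ.≤-refl)
  ... | N , near = N , λ n j q N≤n 2≤jq q∈ →
    let p , p∈ , p∉S          = proj₂ (near n N≤n)
        p₁ , p₁∈ , p<p₁+1     = ∈-+fromℚ⁻ (∑< n f) 1ℚ p∈
        p′ , p′∈ , p′∉        = proj₁ (near (j ℕ.+ n) (ℕ.≤-trans N≤n (ℕ.m≤n+m n j)))
        p₂ , p₂∈S , p′<p₂+1   = ∈-+fromℚ⁻ S 1ℚ p′∈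
    in p′∉ (∈-≤ (∑< (j ℕ.+ n) f) (begin
      p′                        ≤⟨ ℚ.<⇒≤ p′<p₂+1 ⟩
      p₂ ℚ.+ 1ℚ                 ≤⟨ ℚ.+-monoˡ-≤ 1ℚ (∈∉⇒≤ S p₂∈S p∉S) ⟩
      p ℚ.+ 1ℚ                  ≤⟨ ℚ.+-monoˡ-≤ 1ℚ (ℚ.<⇒≤ p<p₁+1) ⟩
      p₁ ℚ.+ 1ℚ ℚ.+ 1ℚ          ≡⟨ ℚ.+-assoc p₁ 1ℚ 1ℚ ⟩
      p₁ ℚ.+ fromℕ 2            ≤⟨ ℚ.+-monoʳ-≤ p₁ 2≤jq ⟩
      p₁ ℚ.+ fromℕ j ℚ.* q      ∎) (∈-∑< f n j p₁∈ q∈))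
    where open ℚ.≤-Reasoning

  converges⇒short-runs : ∀ s 0≤s (δ : ℕ → Maybe ℕ) → SeriesConverges (λ n → term s 0≤s (δ n)) →
    ∃[ M ] ∀ k e → ¬ (∀ j → j ℕ.< M ℕ.+ runLength M e → δ (j ℕ.+ k) ≡ just (suc e))
  converges⇒short-runs s 0≤s δ conv = M , λ k e run →
    let q , 2≤jq , qu<1 = height e in
    -- The first `M` digits of the run are discarded, so that the remaining ones start at M + k ≥ N
    -- wherever the run begins.
    proj₂ bound (M ℕ.+ k) (runLength M e) q (ℕ.≤-trans (ℕ.m≤n⊔m m N) (ℕ.m≤m+n M k)) 2≤jq λ i i<j →
      subst (λ d → q ∈ cut (term s 0≤s d))
        (sym (trans (cong δ (sym (ℕ.+-assoc i M k)))
          (run (i ℕ.+ M) (subst (i ℕ.+ M ℕ.<_) (ℕ.+-comm (runLength M e) M) (ℕ.+-monoˡ-< M i<j)))))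
        (∈-recip (power (suc e) s 0≤s) (power-pos (suc e) s 0≤s) (0<u e)
          (∉-≤ (power (suc e) s 0≤s) (^-monoʳ-≤ (1≤base e) (ℕ.m≤m⊔n m N))
            (proj₂ (power∌ s 0≤s) (suc e))) qu<1)
    where
    bound = converges⇒short-blocks (λ n → term s 0≤s (δ n)) conv
    m N : ℕ
    m = proj₁ (power∌ s 0≤s)
    N = proj₁ bound
    -- M ≥ m gives (e + 1)ˢ ≤ (e + 2)ᴹ, and M ≥ N passes the Cauchy index.
    M : ℕ
    M = m ℕ.⊔ N
    u : ℕ → ℚ
    u e = fromℕ (suc (suc e)) ^ℚ M
    1≤base : ∀ e → 1ℚ ℚ.≤ fromℕ (suc (suc e))
    1≤base e = fromℕ-mono {1} (ℕ.s≤s ℕ.z≤n)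
    0<u : ∀ e → 0ℚ ℚ.< u e
    0<u e = ℚ.<-≤-trans 0<1ℚ (1≤^ M (1≤base e))
    height : ∀ e → ∃[ q ] fromℕ 2 ℚ.≤ fromℕ (runLength M e) ℚ.* q × q ℚ.* u e ℚ.< 1ℚ
    -- q = 1/(2u) is strictly below 1/u, hence below each term, and 4u copies of it sum to 2; this
    -- is the 4 in `runLength`.
    height e = let q , 0<q , 2uq≡1 = inverse (*-pos (0<fromℕ-suc 1) (0<u e)) in
      q ,
      subst₂ ℚ._≤_
        (trans (solve 2 (λ u q → q :* (con (fromℕ 4) :* u) := con (fromℕ 2) :* (con (fromℕ 2) :* u :* q)) refl (u e) q)
          (cong (fromℕ 2 ℚ.*_) 2uq≡1))
        (ℚ.*-comm q (fromℕ (runLength M e)))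
        (*-monoʳ-≤ (ℚ.<⇒≤ 0<q) (proj₂ (archimedean (fromℕ 4 ℚ.* u e)))) ,
      <-slack (q ℚ.* u e) (*-pos 0<q (0<u e))
        (trans (solve 2 (λ u q → q :* u :+ q :* u := con (fromℕ 2) :* u :* q) refl (u e) q) 2uq≡1)

  -- Finite exponents and category

  inf⁺≢⊤⁺⇒inhabited : ∀ S 0≤S → ¬ inf⁺ S 0≤S ≡ ⊤⁺ → ∃ S
  inf⁺≢⊤⁺⇒inhabited S 0≤S ≢⊤⁺ with em {∃ S}
  ... | yes ne = ne
  ... | no  _  = ⊥-elim (≢⊤⁺ refl)

  finite-exponent⇒ShortRuns : ∀ x → ¬ exponent (value x) ≡ ⊤⁺ → ∃[ M ] x ∈ ShortRuns M
  finite-exponent⇒ShortRuns x λx≢⊤⁺ =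
    let s , 0≤s , conv = inf⁺≢⊤⁺⇒inhabited (ConvergenceSet (value x)) (λ _ → proj₁) λx≢⊤⁺ in
    converges⇒short-runs s 0≤s (digit (value x)) conv

  -- Every point of `A` lies in some `ShortRuns M`. The sets are intersected with `A` because
  -- `FirstCategory` asks for equality with the union.
  firstCategory : ∀ {A} → (∀ x → x ∈ A → ¬ exponent (value x) ≡ ⊤⁺) → FirstCategory A
  firstCategory {A} A⊆ = (λ M → A ∩ ShortRuns M) , (λ M → nowhereDense-ShortRuns M {A}) ,
    (λ {x} x∈A → let M , x∈ = finite-exponent⇒ShortRuns x (A⊆ x x∈A) in M , x∈A , x∈) ,
    λ (_ , x∈A , _) → x∈A

theorem3p5 : (em : ExcludedMiddle 0ℓ) → let open Classical em in
    ((α : ℝ) → 0ℝ ≤ α → FirstCategory (λ x → exponent (value x) ≤⁺ [ α ]))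
    × Residual (λ x → exponent (value x) ≡ ⊤⁺)
theorem3p5 em =
  (λ α _ → firstCategory em λ _ λx≤α λx≡⊤⁺ → ⊤⁺≰[ α ] λx≡⊤⁺ λx≤α) ,
  -- Residuality concerns the complement, whose points have finite exponent by definition.
  firstCategory em λ _ λx≢⊤⁺ → λx≢⊤⁺
  where
  ⊤⁺≰[_] : ∀ α {λx} → λx ≡ ⊤⁺ → ¬ λx ≤⁺ [ α ]
  ⊤⁺≰[ _ ] refl ()
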